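{- For any nonempty subsets $A,B\subseteq S(n)$, $$\log|M|\ \ge\ \tfrac12\log|A|+\tfrac12\log|B|+\tfrac{K}{8}\,\mathrm{d}(A,B)^2,\qquad K=\frac{4\log 2}{(n-1)^2},$$ where $M$ is the midpoint set of $A$ and $B$.
   Context: $S(n)$ is the symmetric group on $\{1,\dots,n\}$ ($n\ge 2$), equipped with the graph distance $\mathrm{d}$ of its Cayley graph generated by all transpositions ($\{a,b\}$ is an edge iff $a^{ -1}b$ is a transposition); equivalently $\mathrm{d}(a,b)=n-(\text{number of cycles of }a^{ -1}b)$. A permutation $m$ is a midpoint of $a$ and $b$ if $\mathrm{d}(a,m)+\mathrm{d}(m,b)=\mathrm{d}(a,b)$ and $\mathrm{d}(a,m)-\mathrm{d}(m,b)\in\{ -1,0,1\}$. The midpoint set of $A$ and $B$ is $M=\{m\in S(n): m\text{ is a midpoint of some }a\in A\text{ and }b\in B\}$. $\mathrm{d}(A,B)=\min\{\mathrm{d}(a,b):a\in A,\,b\in B\}$. $|\cdot|$ denotes cardinality. -}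

module Defs where

open import Data.Nat using (ℕ; zero; suc; _+_; _∸_; _⊓_; _≡ᵇ_; _≤ᵇ_)
open import Data.Bool using (Bool; true; false; _∧_; _∨_; not; if_then_else_)
open import Data.Fin using (Fin; toℕ)
open import Data.Fin.Properties using (_≟_)
open import Data.Vec using (Vec; []; _∷_; lookup)
open import Data.List using (List; []; _∷_; [_]; map; concatMap; allFin; upTo; length; foldr)
open import Data.Bool.ListAction using (all; any)
open import Relation.Nullary.Decidable using (⌊_⌋)

-- A permutation of {1..n} is represented by its table  i ↦ σ(i)  as a Vec (Fin n) n.
Perm : ℕ → Set
Perm n = Vec (Fin n) n

filterB : {A : Set} → (A → Bool) → List A → List A
filterB p [] = []
filterB p (x ∷ xs) = if p x then x ∷ filterB p xs else filterB p xs

allVecs : (n k : ℕ) → List (Vec (Fin n) k)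
allVecs n zero = [ [] ]
allVecs n (suc k) = concatMap (λ x → map (x ∷_) (allVecs n k)) (allFin n)

-- injective self-map of Fin n (= bijection, Fin n finite)
isPerm : {n : ℕ} → Perm n → Bool
isPerm {n} v = all (λ i → all (λ j → ⌊ i ≟ j ⌋ ∨ not ⌊ lookup v i ≟ lookup v j ⌋) (allFin n)) (allFin n)

-- the symmetric group S(n), as a duplicate-free list of all permutations
Sym : (n : ℕ) → List (Perm n)
Sym n = filterB isPerm (allVecs n n)

-- inverse by search (correct for genuine permutations)
findOr : {n : ℕ} → (Fin n → Bool) → List (Fin n) → Fin n → Fin n
findOr p [] d = d
findOr p (x ∷ xs) d = if p x then x else findOr p xs d

inv : {n : ℕ} → Perm n → Fin n → Fin n
inv {n} a j = findOr (λ i → ⌊ lookup a i ≟ j ⌋) (allFin n) j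

iter : {n : ℕ} → (Fin n → Fin n) → ℕ → Fin n → Fin n
iter f zero i = i
iter f (suc k) i = f (iter f k i)

-- i is the least element of its cycle (orbit of size ≤ n)
isLeader : {n : ℕ} → (Fin n → Fin n) → Fin n → Bool
isLeader {n} σ i = all (λ k → toℕ i ≤ᵇ toℕ (iter σ k i)) (upTo n)

cycles : {n : ℕ} → (Fin n → Fin n) → ℕ
cycles {n} σ = length (filterB (isLeader σ) (allFin n))

dist : {n : ℕ} → Perm n → Perm n → ℕ
dist {n} a b = n ∸ cycles (λ i → inv a (lookup b i))

isMidpoint : {n : ℕ} → Perm n → Perm n → Perm n → Bool
isMidpoint a b m =
  ((dist a m + dist m b) ≡ᵇ dist a b) ∧ (dist a m ≤ᵇ suc (dist m b)) ∧ (dist m b ≤ᵇ suc (dist a m))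

-- A subset of S(n) is given by a Boolean predicate, restricted to S(n)
Subset : ℕ → Set
Subset n = Perm n → Bool

elems : {n : ℕ} → Subset n → List (Perm n)
elems {n} A = filterB A (Sym n)

card : {n : ℕ} → Subset n → ℕ
card A = length (elems A)

midSet : {n : ℕ} → Subset n → Subset n → List (Perm n)
midSet {n} A B =
  filterB (λ m → any (λ a → any (λ b → isMidpoint a b m) (elems B)) (elems A)) (Sym n)

-- d(A,B) = min over a ∈ A, b ∈ B of d(a,b).  The fold starts at n, which
-- exceeds every distance (≤ n − 1), so for nonempty A, B this is the minimum.
setDist : {n : ℕ} → Subset n → Subset n → ℕ
setDist {n} A B =
  foldr _⊓_ n (concatMap (λ a → map (λ b → dist a b) (elems B)) (elems A))

{-# OPTIONS --safe #-}
module Submission where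

-- Call a product of transpositions (0 x₀), (1 x₁), … with xᵢ > i a star factorisation. Multiplying
-- by (i xᵢ) inserts the fixed point i into the cycle of xᵢ, so each factor costs one cycle. Deal
-- the factors alternately to two permutations τ and κ. Then the lengths of τ and κ differ by at
-- most one and add up to that of τκ. By peeling off one star transposition at a time, every
-- permutation is of the form τκ, every permutation is of the form κτ, and κτ⁻¹ determines τ and κ.
-- Write a⁻¹b = τκ. Then m = aτ and m′ = aτκτ⁻¹ are midpoints of a and b, and m⁻¹m′ = κτ⁻¹ gives
-- back τ and κ, hence a and b: this injects A × B into M × M. Writing a⁻¹b = (κτ)⁻¹ instead, the
-- midpoints m = aκ⁻¹ and m′ = aτ⁻¹ again satisfy m⁻¹m′ = κτ⁻¹ and give a second injection, whose
-- image is disjoint from the first when A ∩ B = ∅. So |M|² ≥ |A||B|, and |M|² ≥ 2|A||B| if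
-- d(A,B) > 0. Since d(A,B) ≤ n − 1, this is all the curvature term asks for.

open import Defs
open import Data.Nat using (ℕ; _≤_; _*_; _^_; _∸_)
open import Data.List using (length)

open import Data.Bool using (Bool; true; false; T; not; _∨_)
open import Data.Bool.Properties using (T?; T-∧; T-∨)
open import Data.Empty using (⊥; ⊥-elim)
open import Data.Fin using (Fin; zero; suc; toℕ)
import Data.Fin.Properties as Fin
open import Data.Fin.Permutation
  using (Permutation′; permutation; _⟨$⟩ʳ_; _⟨$⟩ˡ_; inverseˡ; inverseʳ; _≈_; id; flip; _∘ₚ_;
         lift₀; remove; lift₀-remove; lift₀-cong; lift₀-comp)
open import Data.List
  using (List; []; _∷_; _++_; map; filter; concatMap; allFin; upTo; tabulate;
         cartesianProduct; cartesianProductWith; foldr)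
open import Data.List.Membership.Propositional using (_∈_; lose; find)
open import Data.List.Membership.Propositional.Properties
open import Data.List.Properties using (length-++; length-map; map-tabulate)
open import Data.List.Relation.Unary.All as All using ([]; _∷_)
import Data.List.Relation.Unary.All.Properties as All
open import Data.List.Relation.Unary.AllPairs using ([]; _∷_)
open import Data.List.Relation.Unary.Any using (here; there)
import Data.List.Relation.Unary.Any.Properties as Any
open import Data.List.Relation.Unary.Unique.Propositional using (Unique)
import Data.List.Relation.Unary.Unique.Propositional.Properties as Unique
open import Data.Nat using (zero; suc; _+_; _<_; _⊓_; z≤n; s≤s; _≤ᵇ_)
open import Data.Nat.DivMod using (_%_; _/_; m≡m%n+[m/n]*n; m%n<n)
open import Data.Nat.Induction using (<-rec)
open import Data.Nat.Properties
open import Data.Product using (∃; _×_; _,_; proj₁; proj₂)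
open import Data.Sum using (_⊎_; inj₁; inj₂)
open import Data.Vec using (Vec; lookup) renaming (_∷_ to _∷ᵥ_)
import Data.Vec as Vec
import Data.Vec.Properties as Vec
open import Function using (_∘_; Equivalence)
open import Relation.Binary.PropositionalEquality
open import Relation.Nullary using (¬_; yes; no; contradiction)
open import Relation.Nullary.Decidable using (⌊_⌋; toWitness; fromWitness)

private
  variable
    X Y Z : Set
    n : ℕ

-- Counting

-- Match the head with some `y`, delete `y` from `ys` and recurse on the tail. A relation in place
-- of a function suits partners that are only known to exist, such as a leader of an orbit.
count-by-relation : (R : X → Y → Set) (xs : List X) (ys : List Y) → Unique xs →
  (∀ x → x ∈ xs → ∃ λ y → y ∈ ys × R x y) →
  (∀ {x x′ y} → x ∈ xs → x′ ∈ xs → R x y → R x′ y → x ≡ x′) →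
  length xs ≤ length ys
count-by-relation R [] ys _ _ _ = z≤n
count-by-relation R (x ∷ xs) ys (x∉xs ∷ uxs) total inj
  with y , y∈ys , Rxy ← total x (here refl)
  with ls , rs , refl ← ∈-∃++ y∈ys = begin
    suc (length xs)               ≤⟨ s≤s (count-by-relation R xs (ls ++ rs) uxs total′ inj′) ⟩
    suc (length (ls ++ rs))       ≡⟨ cong suc (length-++ ls) ⟩
    suc (length ls + length rs)   ≡⟨ +-suc (length ls) (length rs) ⟨
    length ls + suc (length rs)   ≡⟨ length-++ ls ⟨
    length (ls ++ y ∷ rs)         ∎
  where
  open ≤-Reasoning
  inj′ : ∀ {u v z} → u ∈ xs → v ∈ xs → R u z → R v z → u ≡ v
  inj′ u∈ v∈ = inj (there u∈) (there v∈)
  total′ : ∀ u → u ∈ xs → ∃ λ z → z ∈ ls ++ rs × R u z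
  total′ u u∈ with total u (there u∈)
  ... | z , z∈ , Ruz with ∈-++⁻ ls z∈
  ... | inj₁ z∈ls = z , ∈-++⁺ˡ z∈ls , Ruz
  ... | inj₂ (there z∈rs) = z , ∈-++⁺ʳ ls z∈rs , Ruz
  -- A later element matched with the deleted `y` would equal `x`, against uniqueness.
  ... | inj₂ (here refl) =
    contradiction (inj (here refl) (there u∈) Rxy Ruz) (All.lookup x∉xs u∈)

length-cartesianProduct : (xs : List X) (ys : List Y) →
  length (cartesianProduct xs ys) ≡ length xs * length ys
length-cartesianProduct [] ys = refl
length-cartesianProduct (x ∷ xs) ys = trans (length-++ (map (x ,_) ys))
  (cong₂ _+_ (length-map (x ,_) ys) (length-cartesianProduct xs ys))

concatMap-cartesianProductWith : (f : X → Y → Z) (xs : List X) (ys : List Y) →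
  concatMap (λ x → map (f x) ys) xs ≡ cartesianProductWith f xs ys
concatMap-cartesianProductWith f [] ys = refl
concatMap-cartesianProductWith f (x ∷ xs) ys =
  cong (map (f x) ys ++_) (concatMap-cartesianProductWith f xs ys)

filterB-filter : (p : X → Bool) (xs : List X) → filterB p xs ≡ filter (T? ∘ p) xs
filterB-filter p [] = refl
filterB-filter p (x ∷ xs) with p x
... | true  = cong (x ∷_) (filterB-filter p xs)
... | false = filterB-filter p xs

∈-filterB⁺ : (p : X → Bool) {x : X} {xs : List X} → x ∈ xs → T (p x) → x ∈ filterB p xs
∈-filterB⁺ p {xs = xs} x∈ px rewrite filterB-filter p xs = ∈-filter⁺ (T? ∘ p) x∈ px

∈-filterB⁻ : (p : X → Bool) {x : X} (xs : List X) → x ∈ filterB p xs → x ∈ xs × T (p x)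
∈-filterB⁻ p xs x∈ rewrite filterB-filter p xs = ∈-filter⁻ (T? ∘ p) x∈

filterB-unique : (p : X → Bool) {xs : List X} → Unique xs → Unique (filterB p xs)
filterB-unique p {xs} u rewrite filterB-filter p xs = Unique.filter⁺ (T? ∘ p) u

length-filterB-map : (f : X → Y) (p : Y → Bool) (q : X → Bool) →
  (∀ x → T (p (f x)) → T (q x)) → (∀ x → T (q x) → T (p (f x))) → (xs : List X) →
  length (filterB p (map f xs)) ≡ length (filterB q xs)
length-filterB-map f p q p⇒q q⇒p [] = refl
length-filterB-map f p q p⇒q q⇒p (x ∷ xs) with p (f x) | q x | p⇒q x | q⇒p x
... | true  | true  | _ | _ = cong suc (length-filterB-map f p q p⇒q q⇒p xs)
... | false | false | _ | _ = length-filterB-map f p q p⇒q q⇒p xs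
... | true  | false | h | _ = ⊥-elim (h _)
... | false | true  | _ | h = ⊥-elim (h _)

-- Orbits

Injective : (Fin n → Fin n) → Set
Injective f = ∀ {i j} → f i ≡ f j → i ≡ j

iter-+ : (f : Fin n → Fin n) (k l : ℕ) (i : Fin n) → iter f (k + l) i ≡ iter f k (iter f l i)
iter-+ f zero l i = refl
iter-+ f (suc k) l i = cong f (iter-+ f k l i)

iter-injective : {f : Fin n → Fin n} → Injective f → ∀ k → Injective (iter f k)
iter-injective inj zero eq = eq
iter-injective inj (suc k) eq = iter-injective inj k (inj eq)

iter-* : (f : Fin n → Fin n) (p : ℕ) (i : Fin n) → iter f p i ≡ i → ∀ q → iter f (q * p) i ≡ i
iter-* f p i eq zero = refl
iter-* f p i eq (suc q) = trans (iter-+ f p (q * p) i) (trans (cong (iter f p) (iter-* f p i eq q)) eq)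

-- Two of the iterates with exponents 0 to `n` agree by pigeonhole, and the smaller exponent
-- cancels.
period : (f : Fin n → Fin n) → Injective f → ∀ i → ∃ λ p → p < n × iter f (suc p) i ≡ i
period {n} f inj i
  with k , l , k<l , eq ← Fin.pigeonhole (n<1+n n) (λ k → iter f (toℕ k) i)
  with m≤n⇒∃[o]m+o≡n k<l
... | p , k+p≡l = p , p<n , iter-injective inj (toℕ k) (sym (begin
    iter f (toℕ k) i                    ≡⟨ eq ⟩
    iter f (toℕ l) i                    ≡⟨ cong (λ z → iter f z i) (trans (sym k+p≡l) (sym (+-suc (toℕ k) p))) ⟩
    iter f (toℕ k + suc p) i            ≡⟨ iter-+ f (toℕ k) (suc p) i ⟩
    iter f (toℕ k) (iter f (suc p) i)   ∎))
  where
  open ≡-Reasoning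
  p<n : p < n
  p<n = ≤-trans (s≤s (m≤n+m p (toℕ k))) (≤-trans (≤-reflexive k+p≡l) (≤-pred (Fin.toℕ<n l)))

-- Exponents are reduced modulo the period. So the first `n` iterates exhaust the orbit, which is as
-- far as `isLeader` looks.
iter-bounded : (f : Fin n → Fin n) → Injective f → ∀ i k → ∃ λ l → l < n × iter f l i ≡ iter f k i
iter-bounded f inj i k with p , p<n , eq ← period f inj i =
  k % suc p , ≤-trans (m%n<n k (suc p)) p<n , sym (begin
    iter f k i                                            ≡⟨ cong (λ z → iter f z i) (m≡m%n+[m/n]*n k (suc p)) ⟩
    iter f (k % suc p + k / suc p * suc p) i              ≡⟨ iter-+ f (k % suc p) _ i ⟩
    iter f (k % suc p) (iter f (k / suc p * suc p) i)     ≡⟨ cong (iter f (k % suc p)) (iter-* f (suc p) i eq (k / suc p)) ⟩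
    iter f (k % suc p) i                                  ∎)
  where open ≡-Reasoning

Orbit : (Fin n → Fin n) → Fin n → Fin n → Set
Orbit f i j = ∃ λ k → iter f k i ≡ j

orbit-refl : {f : Fin n → Fin n} {i : Fin n} → Orbit f i i
orbit-refl = 0 , refl

orbit-step : (f : Fin n → Fin n) (i : Fin n) → Orbit f i (f i)
orbit-step f i = 1 , refl

orbit-trans : {f : Fin n → Fin n} {i j k : Fin n} → Orbit f i j → Orbit f j k → Orbit f i k
orbit-trans {f = f} {i} (p , refl) (q , refl) = q + p , iter-+ f q p i

-- With period `suc p`, another `k * p` steps extend the `k` steps already made to `k` full periods.
orbit-sym : {f : Fin n → Fin n} → Injective f → ∀ {i j} → Orbit f i j → Orbit f j i
orbit-sym {f = f} inj {i} (k , refl) with p , _ , eq ← period f inj i = k * p , (begin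
    iter f (k * p) (iter f k i)   ≡⟨ iter-+ f (k * p) k i ⟨
    iter f (k * p + k) i          ≡⟨ cong (λ z → iter f z i) (trans (+-comm (k * p) k) (sym (*-suc k p))) ⟩
    iter f (k * suc p) i          ≡⟨ iter-* f (suc p) i eq k ⟩
    i                             ∎)
  where open ≡-Reasoning

orbit-map : ∀ {m} {f : Fin n → Fin n} {g : Fin m → Fin m} (φ : Fin n → Fin m) →
  (∀ i → Orbit g (φ i) (φ (f i))) → ∀ {i j} → Orbit f i j → Orbit g (φ i) (φ j)
orbit-map φ step (zero , refl) = orbit-refl
orbit-map φ step (suc k , refl) = orbit-trans (orbit-map φ step (k , refl)) (step _)

Leader : (Fin n → Fin n) → Fin n → Set
Leader f i = ∀ j → Orbit f i j → toℕ i ≤ toℕ j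

isLeader⇒Leader : {f : Fin n → Fin n} → Injective f → ∀ i → T (isLeader f i) → Leader f i
isLeader⇒Leader {n} {f} inj i h j (k , refl) with l , l<n , eq ← iter-bounded f inj i k =
  subst (λ z → toℕ i ≤ toℕ z) eq
    (≤ᵇ⇒≤ _ _ (All.lookup (All.all⁺ _ (upTo n) h) (∈-upTo⁺ l<n)))

Leader⇒isLeader : (f : Fin n → Fin n) → ∀ i → Leader f i → T (isLeader f i)
Leader⇒isLeader {n} f i h =
  All.all⁻ _ {xs = upTo n} (All.tabulate λ {k} _ → ≤⇒≤ᵇ (h _ (k , refl)))

leader-or-smaller : {f : Fin n → Fin n} → ∀ i →
  T (isLeader f i) ⊎ ∃ λ j → Orbit f i j × toℕ j < toℕ i
leader-or-smaller {n} {f} i with T? (isLeader f i)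
... | yes t = inj₁ t
... | no ¬t with All.¬All⇒Any¬ (λ k → T? (toℕ i ≤ᵇ toℕ (iter f k i))) (upTo n) (¬t ∘ All.all⁻ _ {xs = upTo n})
... | any with k , _ , ¬≤ ← find any = inj₂ (iter f k i , (k , refl) , ≰⇒> (¬≤ ∘ ≤⇒≤ᵇ))

-- Descent: a point that is not a leader has a smaller point in its orbit.
leader-exists : (f : Fin n → Fin n) → ∀ i → ∃ λ j → T (isLeader f j) × Orbit f i j
leader-exists f i = <-rec (λ k → ∀ i → toℕ i ≡ k → ∃ λ j → T (isLeader f j) × Orbit f i j) go (toℕ i) i refl
  where
  go : ∀ k → (∀ {l} → l < k → ∀ i → toℕ i ≡ l → ∃ λ j → T (isLeader f j) × Orbit f i j) →
       ∀ i → toℕ i ≡ k → ∃ λ j → T (isLeader f j) × Orbit f i j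
  go k rec i refl with leader-or-smaller {f = f} i
  ... | inj₁ t = i , t , orbit-refl
  ... | inj₂ (j , i~j , j<i) with l , t , j~l ← rec j<i j refl = l , t , orbit-trans i~j j~l

perm-injective : (π : Permutation′ n) → Injective (π ⟨$⟩ʳ_)
perm-injective π {i} {j} eq = trans (sym (inverseˡ π)) (trans (cong (π ⟨$⟩ˡ_) eq) (inverseˡ π))

cyc : Permutation′ n → ℕ
cyc π = cycles (π ⟨$⟩ʳ_)

-- Each leader `i` of `π` is matched with a leader in the `ρ`-orbit of `φ i`. Two leaders with the
-- same match lie in one `π`-orbit by reflection, and both are its least element.
cyc-≤ : ∀ {m} (π : Permutation′ m) (ρ : Permutation′ n) (φ : Fin m → Fin n) →
  (∀ {i j} → Orbit (ρ ⟨$⟩ʳ_) (φ i) (φ j) → Orbit (π ⟨$⟩ʳ_) i j) → cyc π ≤ cyc ρ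
cyc-≤ {n} {m} π ρ φ reflect =
  count-by-relation (λ i j → Orbit g (φ i) j) _ _ (filterB-unique (isLeader f) (Unique.allFin⁺ m))
    (λ i _ → let j , t , o = leader-exists g (φ i)
             in j , ∈-filterB⁺ (isLeader g) (∈-allFin j) t , o)
    λ i∈ i′∈ o o′ → let i~i′ = reflect (orbit-trans o (orbit-sym (perm-injective ρ) o′)) in
      Fin.toℕ-injective (≤-antisym
        (leads i∈ i~i′)
        (leads i′∈ (orbit-sym (perm-injective π) i~i′)))
  where
  f = π ⟨$⟩ʳ_
  g = ρ ⟨$⟩ʳ_
  leads : ∀ {i j} → i ∈ filterB (isLeader f) (allFin m) → Orbit f i j → toℕ i ≤ toℕ j
  leads i∈ o = isLeader⇒Leader (perm-injective π) _ (proj₂ (∈-filterB⁻ (isLeader f) (allFin m) i∈)) _ o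

flip-≈ : (α β : Permutation′ n) → α ≈ flip β → flip α ≈ β
flip-≈ α β eq i = perm-injective (flip β) (trans (trans (sym (eq _)) (inverseʳ α)) (sym (inverseˡ β)))

-- Cycle counts of permutations

infixl 9 _·_
_·_ : Permutation′ n → Permutation′ n → Permutation′ n
α · β = β ∘ₚ α

cyc-cong : {π ρ : Permutation′ n} → π ≈ ρ → cyc π ≡ cyc ρ
cyc-cong {π = π} {ρ} eq = ≤-antisym
  (cyc-≤ π ρ _ (orbit-map (λ i → i) λ i → 1 , eq i))
  (cyc-≤ ρ π _ (orbit-map (λ i → i) λ i → 1 , sym (eq i)))

cyc-flip-≤ : (π : Permutation′ n) → cyc π ≤ cyc (flip π)
cyc-flip-≤ π = cyc-≤ π (flip π) _
  (orbit-map (λ i → i) λ i → orbit-sym (perm-injective π) (1 , inverseʳ π))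

cyc-flip : (π : Permutation′ n) → cyc (flip π) ≡ cyc π
cyc-flip π = ≤-antisym (cyc-flip-≤ (flip π)) (cyc-flip-≤ π)

-- Applying `α` to a path of `β · α` from `β i` to `β j` gives a path of `α · β` from the successor
-- of `i` to the successor of `j`.
cyc-comm-≤ : (α β : Permutation′ n) → cyc (α · β) ≤ cyc (β · α)
cyc-comm-≤ α β = cyc-≤ (α · β) (β · α) (β ⟨$⟩ʳ_) λ {i} {j} o →
  orbit-trans (orbit-step _ i) (orbit-trans
    (orbit-map (α ⟨$⟩ʳ_) (λ _ → 1 , refl) o)
    (orbit-sym (perm-injective (α · β)) (orbit-step _ j)))

cyc-comm : (α β : Permutation′ n) → cyc (α · β) ≡ cyc (β · α)
cyc-comm α β = ≤-antisym (cyc-comm-≤ α β) (cyc-comm-≤ β α)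

cyc-conj : (α β : Permutation′ n) → cyc (α · β · flip α) ≡ cyc β
cyc-conj α β = trans (cyc-comm (α · β) (flip α)) 
  (cyc-cong {π = flip α · (α · β)} {β} λ i → inverseˡ α)

zero-leads : (f : Fin (suc n) → Fin (suc n)) → T (isLeader f zero)
zero-leads f = Leader⇒isLeader f zero λ _ _ → z≤n

iter-lift₀ : (π : Permutation′ n) → ∀ k i → iter (lift₀ π ⟨$⟩ʳ_) k (suc i) ≡ suc (iter (π ⟨$⟩ʳ_) k i)
iter-lift₀ π zero i = refl
iter-lift₀ π (suc k) i = cong (lift₀ π ⟨$⟩ʳ_) (iter-lift₀ π k i)

filterB-accept : (p : X → Bool) (x : X) (xs : List X) → T (p x) → filterB p (x ∷ xs) ≡ x ∷ filterB p xs
filterB-accept p x xs t with true ← p x = refl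

cyc-lift₀ : (π : Permutation′ n) → cyc (lift₀ π) ≡ suc (cyc π)
cyc-lift₀ {n} π = begin
  cyc (lift₀ π)                                       ≡⟨ cong length (filterB-accept p zero (tabulate suc) (zero-leads g)) ⟩
  suc (length (filterB p (tabulate suc)))             ≡⟨ cong (λ z → suc (length (filterB p z))) (map-tabulate (λ i → i) suc) ⟨
  suc (length (filterB p (map suc (allFin n))))       ≡⟨ cong suc (length-filterB-map suc p (isLeader f) down up (allFin n)) ⟩
  suc (cyc π)                                         ∎
  where
  open ≡-Reasoning
  f = π ⟨$⟩ʳ_
  g = lift₀ π ⟨$⟩ʳ_
  p = isLeader g
  down : ∀ i → T (p (suc i)) → T (isLeader f i)
  down i t = Leader⇒isLeader f i λ { _ (k , refl) →
    ≤-pred (isLeader⇒Leader (perm-injective (lift₀ π)) (suc i) t _ (k , iter-lift₀ π k i)) }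
  up : ∀ i → T (isLeader f i) → T (p (suc i))
  up i t = Leader⇒isLeader g (suc i) λ { _ (k , refl) →
    subst (λ z → suc (toℕ i) ≤ toℕ z) (sym (iter-lift₀ π k i))
      (s≤s (isLeader⇒Leader (perm-injective π) i t _ (k , refl))) }

-- Star transpositions

starFun : Fin n → Fin (suc n) → Fin (suc n)
starFun x zero = suc x
starFun x (suc j) with j Fin.≟ x
... | yes _ = zero
... | no _ = suc j

starFun-hit : (x : Fin n) → starFun x (suc x) ≡ zero
starFun-hit x with x Fin.≟ x
... | yes _ = refl
... | no x≢x = contradiction refl x≢x

starFun-miss : {x j : Fin n} → j ≢ x → starFun x (suc j) ≡ suc j
starFun-miss {x = x} {j} j≢x with j Fin.≟ x
... | yes j≡x = contradiction j≡x j≢x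
... | no _ = refl

starFun-involutive : (x : Fin n) (i : Fin (suc n)) → starFun x (starFun x i) ≡ i
starFun-involutive x zero = starFun-hit x
starFun-involutive x (suc j) with j Fin.≟ x
... | yes refl = refl
... | no j≢x = starFun-miss j≢x

-- The transposition (0 x), with x shifted by one.
star : Fin n → Permutation′ (suc n)
star x = permutation (starFun x) (starFun x) (starFun-involutive x) (starFun-involutive x)

-- Conjugating (0 x) by a permutation that fixes 0 only relabels x. This moves a star factor to the
-- front of a product.
lift₀-star : (π : Permutation′ n) (x : Fin n) → lift₀ π · star x ≈ star (π ⟨$⟩ʳ x) · lift₀ π
lift₀-star π x zero = refl
lift₀-star π x (suc j) with j Fin.≟ x
... | yes refl = sym (starFun-hit (π ⟨$⟩ʳ j))
... | no j≢x = sym (starFun-miss (j≢x ∘ perm-injective π))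

-- Multiplying by (0 x) inserts the fixed point 0 into the cycle of x.
cyc-star : (x : Fin n) (π : Permutation′ n) → cyc (star x · lift₀ π) ≡ cyc π
cyc-star {n} x π = ≤-antisym
  (cyc-≤ ρ π r λ {i} {j} o → orbit-trans (enter i) (orbit-trans (orbit-map suc step o)
    (orbit-sym (perm-injective ρ) (enter j))))
  (cyc-≤ π ρ suc (orbit-map r back))
  where
  ρ = star x · lift₀ π
  -- The inserted point 0 is followed by `suc x`, so `r` collapses it onto `x` without leaving the
  -- cycle.
  r : Fin (suc n) → Fin n
  r zero = x
  r (suc j) = j
  enter : ∀ i → Orbit (ρ ⟨$⟩ʳ_) i (suc (r i))
  enter zero = 1 , refl
  enter (suc j) = orbit-refl
  step : ∀ i → Orbit (ρ ⟨$⟩ʳ_) (suc i) (suc (π ⟨$⟩ʳ i))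
  step i with π ⟨$⟩ʳ i in eq
  ... | y with y Fin.≟ x
  ... | no y≢x = 1 , trans (cong (starFun x ∘ suc) eq) (starFun-miss y≢x)
  -- Where `π` hits `x`, `ρ` makes the detour through 0 and takes two steps.
  ... | yes refl = 2 , cong (ρ ⟨$⟩ʳ_) (trans (cong (starFun x ∘ suc) eq) (starFun-hit x))
  back : ∀ i → Orbit (π ⟨$⟩ʳ_) (r i) (r (ρ ⟨$⟩ʳ i))
  back zero = orbit-refl
  back (suc j) with π ⟨$⟩ʳ j Fin.≟ x
  ... | yes eq = 1 , eq
  ... | no _ = 1 , refl

star-left-injective : {x y : Fin n} (α β : Permutation′ n) →
  star x · lift₀ α ≈ star y · lift₀ β → x ≡ y × α ≈ β
star-left-injective {x = x} α β eq with refl ← eq zero =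
  refl , λ i → Fin.suc-injective (perm-injective (star x) (eq (suc i)))

star-right-injective : {x y : Fin n} (α β : Permutation′ n) →
  lift₀ α · star x ≈ lift₀ β · star y → x ≡ y × α ≈ β
star-right-injective {x = x} {y} α β eq = x≡y , α≈β x≡y eq
  where
  open ≡-Reasoning
  -- `suc x` is the point that `lift₀ α · star x` sends to 0, so it reveals `x`.
  hit : lift₀ β ⟨$⟩ʳ starFun y (suc x) ≡ zero
  hit = trans (sym (eq (suc x))) (cong (lift₀ α ⟨$⟩ʳ_) (starFun-hit x))
  x≡y : x ≡ y
  x≡y = Fin.suc-injective (perm-injective (star y)
    (trans (perm-injective (lift₀ β) {j = zero} hit) (sym (starFun-hit y))))
  α≈β : ∀ {y} → x ≡ y → lift₀ α · star x ≈ lift₀ β · star y → α ≈ β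
  α≈β refl eq i = Fin.suc-injective (begin
    lift₀ α ⟨$⟩ʳ suc i                              ≡⟨ cong (lift₀ α ⟨$⟩ʳ_) (starFun-involutive x (suc i)) ⟨
    lift₀ α ⟨$⟩ʳ starFun x (starFun x (suc i))      ≡⟨ eq (starFun x (suc i)) ⟩
    lift₀ β ⟨$⟩ʳ starFun x (starFun x (suc i))      ≡⟨ cong (lift₀ β ⟨$⟩ʳ_) (starFun-involutive x (suc i)) ⟩
    lift₀ β ⟨$⟩ʳ suc i                              ∎)

-- If `π` sends 0 to `suc x`, then `star x · π` fixes 0, and `star x` is an involution.
strip : (π : Permutation′ (suc n)) →
  (∃ λ ρ → lift₀ ρ ≈ π) ⊎ (∃ λ x → ∃ λ ρ → star x · lift₀ ρ ≈ π)
strip π with π ⟨$⟩ʳ zero in eq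
... | zero = inj₁ (remove zero π , lift₀-remove π eq)
... | suc x = inj₂ (x , remove zero π′ , λ i →
    trans (cong (starFun x) (lift₀-remove π′ fixes i)) (starFun-involutive x _))
  where
  π′ = star x · π
  fixes : starFun x (π ⟨$⟩ʳ zero) ≡ zero
  fixes = trans (cong (starFun x) eq) (starFun-hit x)

-- Products of star transpositions

-- A choice of transpositions (0 x₀), (1 x₁), (2 x₂), … with xᵢ > i, some of them omitted by fix.
data Code : ℕ → Set where
  []   : Code zero
  fix  : Code n → Code (suc n)
  swap : Fin n → Code n → Code (suc n)

-- The chosen transpositions are dealt alternately to  half true  and  half false.
half : Bool → Code n → Permutation′ n
half b     []         = id
half b     (fix c)    = lift₀ (half b c)
half true  (swap x c) = star x · lift₀ (half false c)
half false (swap x c) = lift₀ (half true c)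

size : Bool → Code n → ℕ
size b     []         = 0
size b     (fix c)    = size b c
size true  (swap x c) = suc (size false c)
size false (swap x c) = size true c

-- The outermost swap always goes to `half true`, which is therefore level or one ahead. A swap
-- exchanges the roles of the halves and with them the two inequalities.
size-balanced : (c : Code n) → size false c ≤ size true c × size true c ≤ suc (size false c)
size-balanced [] = z≤n , z≤n
size-balanced (fix c) = size-balanced c
size-balanced (swap x c) with f≤t , t≤1+f ← size-balanced c = t≤1+f , s≤s f≤t

cyc-id : ∀ n → cyc (id {n}) ≡ n
cyc-id zero = refl
cyc-id (suc n) = trans (cyc-cong {π = id {suc n}} {lift₀ (id {n})} λ { zero → refl ; (suc i) → refl })
  (trans (cyc-lift₀ (id {n})) (cong suc (cyc-id n)))

cyc-half : (b : Bool) (c : Code n) → cyc (half b c) + size b c ≡ n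
cyc-half b [] = refl
cyc-half b (fix c) = trans (cong (_+ size b c) (cyc-lift₀ (half b c))) (cong suc (cyc-half b c))
cyc-half true (swap x c) = trans (+-suc _ _)
  (cong suc (trans (cong (_+ size false c) (cyc-star x (half false c))) (cyc-half false c)))
cyc-half false (swap x c) =
  trans (cong (_+ size true c) (cyc-lift₀ (half true c))) (cong suc (cyc-half true c))

lift₀-· : (α β : Permutation′ n) → lift₀ (α · β) ≈ lift₀ α · lift₀ β
lift₀-· α β i = sym (lift₀-comp β α i)

halves-swap-true : (x : Fin n) (c : Code n) →
  half true (swap x c) · half false (swap x c) ≈ star x · lift₀ (half false c · half true c)
halves-swap-true x c i = sym (cong (starFun x) (lift₀-· (half false c) (half true c) i))

-- Here the star factor sits between the two lifted halves; bringing it to the front relabels `x` by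
-- `half true c`.
halves-swap-false : (x : Fin n) (c : Code n) →
  half false (swap x c) · half true (swap x c)
    ≈ star (half true c ⟨$⟩ʳ x) · lift₀ (half true c · half false c)
halves-swap-false x c i =
  trans (lift₀-star (half true c) x (lift₀ (half false c) ⟨$⟩ʳ i))
    (sym (cong (starFun (half true c ⟨$⟩ʳ x)) (lift₀-· (half true c) (half false c) i)))

star-lift₀-cong : {x y : Fin n} {α β : Permutation′ n} → x ≡ y → α ≈ β → star x · lift₀ α ≈ star y · lift₀ β
star-lift₀-cong {x = x} {α = α} {β} refl eq i = cong (starFun x) (lift₀-cong α β eq i)

-- Both orders of multiplication share one induction, since removing a swap exchanges the halves;
-- each swap costs one cycle by `cyc-star`. With `cyc-half` this makes the product of the halves
-- geodesic.
cyc-halves : (b : Bool) (c : Code n) →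
  cyc (half b c · half (not b) c) + (size b c + size (not b) c) ≡ n
cyc-halves true [] = refl
cyc-halves false [] = refl
cyc-halves b (fix c) = trans
  (cong (_+ (size b c + size (not b) c)) (trans
    (sym (cyc-cong {π = lift₀ (half b c · half (not b) c)} {lift₀ (half b c) · lift₀ (half (not b) c)}
      (lift₀-· (half b c) (half (not b) c))))
    (cyc-lift₀ (half b c · half (not b) c))))
  (cong suc (cyc-halves b c))
cyc-halves true (swap x c) = trans (+-suc _ _) (cong suc (trans
  (cong (_+ (size false c + size true c)) (trans
    (cyc-cong {π = half true (swap x c) · half false (swap x c)} {star x · lift₀ σ}
      (halves-swap-true x c))
    (cyc-star x σ)))
  (cyc-halves false c)))
  where σ = half false c · half true c
cyc-halves false (swap x c) = trans
  (cong (cyc (half false (swap x c) · half true (swap x c)) +_) (+-suc _ _))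
  (trans (+-suc _ _) (cong suc (trans
    (cong (_+ (size true c + size false c)) (trans
      (cyc-cong {π = half false (swap x c) · half true (swap x c)} {star y · lift₀ σ}
        (halves-swap-false x c))
      (cyc-star y σ)))
    (cyc-halves true c))))
  where
  σ = half true c · half false c
  y = half true c ⟨$⟩ʳ x

halves-surjective : (b : Bool) (π : Permutation′ n) → ∃ λ c → half b c · half (not b) c ≈ π
halves-surjective {zero} b π = [] , λ ()
halves-surjective {suc n} b π with strip π
... | inj₁ (ρ , eq) with c , ih ← halves-surjective b ρ =
  fix c , λ i → trans (sym (lift₀-· (half b c) (half (not b) c) i))
    (trans (lift₀-cong (half b c · half (not b) c) ρ ih i) (eq i))
halves-surjective {suc n} true π | inj₂ (x , ρ , eq)
  with c , ih ← halves-surjective false ρ =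
  swap x c , λ i → trans (halves-swap-true x c i)
    (trans (star-lift₀-cong {α = half false c · half true c} {ρ} refl ih i) (eq i))
halves-surjective {suc n} false π | inj₂ (x , ρ , eq)
  with c , ih ← halves-surjective true ρ =
  -- Bringing the factor to the front will apply `half true c` to its label, so the label is taken
  -- to be the preimage of `x`.
  let y = half true c ⟨$⟩ˡ x in
  swap y c , λ i → trans (halves-swap-false y c i)
    (trans (star-lift₀-cong {α = half true c · half false c} {ρ} (inverseʳ (half true c)) ih i) (eq i))

-- For τ = `half true c` and κ = `half false c`, `ratio true c` is κτ⁻¹ and `ratio false c` its
-- inverse. The induction alternates between them.
ratio : Bool → Code n → Permutation′ n
ratio b c = half (not b) c · flip (half b c)

ratio-fix : (b : Bool) (c : Code n) → ratio b (fix c) ≈ lift₀ (ratio b c)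
ratio-fix b c zero = refl
ratio-fix b c (suc i) = refl

ratio-swap-true : (x : Fin n) (c : Code n) → ratio true (swap x c) ≈ lift₀ (ratio false c) · star x
ratio-swap-true x c i with starFun x i
... | zero = refl
... | suc j = refl

ratio-swap-false : (x : Fin n) (c : Code n) → ratio false (swap x c) ≈ star x · lift₀ (ratio true c)
ratio-swap-false x c zero = refl
ratio-swap-false x c (suc i) = refl

ratio-swap≢0 : (b : Bool) (x : Fin n) (c : Code n) → ratio b (swap x c) ⟨$⟩ʳ zero ≢ zero
ratio-swap≢0 true x c ()
ratio-swap≢0 false x c ()

-- The image of 0 tells `fix` from `swap`. The ratio of a swap keeps its star factor at an outer
-- end, right for `true` and left for `false`, where it can be read off and cancelled.
ratio-injective : (b : Bool) (c d : Code n) → ratio b c ≈ ratio b d → c ≡ d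
ratio-injective b [] [] eq = refl
ratio-injective b (fix c) (fix d) eq =
  cong fix (ratio-injective b c d λ i → Fin.suc-injective (eq (suc i)))
ratio-injective b (fix c) (swap y d) eq = contradiction (sym (eq zero)) (ratio-swap≢0 b y d)
ratio-injective b (swap x c) (fix d) eq = contradiction (eq zero) (ratio-swap≢0 b x c)
ratio-injective true (swap x c) (swap y d) eq
  with x≡y , eq′ ← star-right-injective (ratio false c) (ratio false d)
         (λ i → trans (sym (ratio-swap-true x c i)) (trans (eq i) (ratio-swap-true y d i)))
  = cong₂ swap x≡y (ratio-injective false c d eq′)
ratio-injective false (swap x c) (swap y d) eq
  with x≡y , eq′ ← star-left-injective (ratio true c) (ratio true d)
         (λ i → trans (sym (ratio-swap-false x c i)) (trans (eq i) (ratio-swap-false y d i)))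
  = cong₂ swap x≡y (ratio-injective true c d eq′)

-- Permutation tables

Inj : Perm n → Set
Inj a = Injective (lookup a)

T-not⇒¬T : ∀ {b} → T (not b) → ¬ T b
T-not⇒¬T {false} _ ()

¬T⇒T-not : ∀ {b} → ¬ T b → T (not b)
¬T⇒T-not {false} _ = _
¬T⇒T-not {true} h = ⊥-elim (h _)

isPerm⇒Inj : (a : Perm n) → T (isPerm a) → Inj a
isPerm⇒Inj {n} a t {i} {j} eq
  with Equivalence.to (T-∨ {⌊ i Fin.≟ j ⌋} {not ⌊ lookup a i Fin.≟ lookup a j ⌋})
         (All.lookup (All.all⁺ _ (allFin n) (All.lookup (All.all⁺ _ (allFin n) t) (∈-allFin i))) (∈-allFin j))
... | inj₁ i≡j = toWitness i≡j
... | inj₂ ¬eq = contradiction (fromWitness eq) (T-not⇒¬T ¬eq)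

Inj⇒isPerm : (a : Perm n) → Inj a → T (isPerm a)
Inj⇒isPerm {n} a inj =
  All.all⁻ _ {xs = allFin n} (All.tabulate λ {i} _ →
    All.all⁻ _ {xs = allFin n} (All.tabulate λ {j} _ → entry i j))
  where
  entry : ∀ i j → T (⌊ i Fin.≟ j ⌋ ∨ not ⌊ lookup a i Fin.≟ lookup a j ⌋)
  entry i j with i Fin.≟ j
  ... | yes _ = _
  ... | no i≢j = ¬T⇒T-not (i≢j ∘ inj ∘ toWitness)

allVecs-product : ∀ n k → allVecs n (suc k) ≡ cartesianProductWith _∷ᵥ_ (allFin n) (allVecs n k)
allVecs-product n k = concatMap-cartesianProductWith _∷ᵥ_ (allFin n) (allVecs n k)

∈-allVecs : ∀ {k} (v : Vec (Fin n) k) → v ∈ allVecs n k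
∈-allVecs Vec.[] = here refl
∈-allVecs {n} {suc k} (x Vec.∷ v) = subst (_ ∈_) (sym (allVecs-product n k))
  (∈-cartesianProductWith⁺ _∷ᵥ_ (∈-allFin x) (∈-allVecs v))

allVecs-unique : ∀ n k → Unique (allVecs n k)
allVecs-unique n zero = [] ∷ []
allVecs-unique n (suc k) = subst Unique (sym (allVecs-product n k))
  (Unique.cartesianProductWith⁺ _∷ᵥ_ Vec.∷-injective (Unique.allFin⁺ n) (allVecs-unique n k))

∈-Sym : {a : Perm n} → Inj a → a ∈ Sym n
∈-Sym {a = a} inj = ∈-filterB⁺ isPerm (∈-allVecs a) (Inj⇒isPerm a inj)

elems-unique : (A : Subset n) → Unique (elems A)
elems-unique {n} A = filterB-unique A (filterB-unique isPerm (allVecs-unique n n))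

elems-Inj : (A : Subset n) {a : Perm n} → a ∈ elems A → Inj a
elems-Inj {n} A {a} a∈ =
  isPerm⇒Inj a (proj₂ (∈-filterB⁻ isPerm (allVecs n n) (proj₁ (∈-filterB⁻ A (Sym n) a∈))))

findOr-sound : (p : Fin n → Bool) {i : Fin n} (xs : List (Fin n)) (d : Fin n) →
  i ∈ xs → T (p i) → T (p (findOr p xs d))
findOr-sound p (x ∷ xs) d i∈ t with p x in eq | i∈
... | true  | _ rewrite eq = _
... | false | here refl rewrite eq = ⊥-elim t
... | false | there i∈xs = findOr-sound p xs d i∈xs t

inv-right : (a : Perm n) → Inj a → ∀ j → lookup a (inv a j) ≡ j
-- As `suc p` is a period, `iter (lookup a) p j` is a preimage of `j`, so the search in `inv` does
-- not end in its default.
inv-right {n} a inj j with p , _ , eq ← period (lookup a) inj j =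
  toWitness (findOr-sound (λ i → ⌊ lookup a i Fin.≟ j ⌋) (allFin n) j (∈-allFin _) (fromWitness eq))

inv-left : (a : Perm n) → Inj a → ∀ i → inv a (lookup a i) ≡ i
inv-left a inj i = inj (inv-right a inj (lookup a i))

toPerm : (a : Perm n) → Inj a → Permutation′ n
toPerm a inj = permutation (lookup a) (inv a) (inv-right a inj) (inv-left a inj)

infixl 8 _⊙_
_⊙_ : Perm n → Permutation′ n → Perm n
a ⊙ π = Vec.tabulate (λ i → lookup a (π ⟨$⟩ʳ i))

⊙-lookup : (a : Perm n) (π : Permutation′ n) → ∀ i → lookup (a ⊙ π) i ≡ lookup a (π ⟨$⟩ʳ i)
⊙-lookup a π = Vec.lookup∘tabulate _

⊙-assoc : (a : Perm n) (α β : Permutation′ n) → a ⊙ α ⊙ β ≡ a ⊙ (α · β)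
⊙-assoc a α β = Vec.tabulate-cong λ i → ⊙-lookup a α (β ⟨$⟩ʳ i)

⊙-cong : (a : Perm n) {α β : Permutation′ n} → α ≈ β → a ⊙ α ≡ a ⊙ β
⊙-cong a eq = Vec.tabulate-cong λ i → cong (lookup a) (eq i)

⊙-id : (a : Perm n) → a ⊙ id ≡ a
⊙-id = Vec.tabulate∘lookup

⊙-Inj : (a : Perm n) (π : Permutation′ n) → Inj a → Inj (a ⊙ π)
⊙-Inj a π inj {i} {j} eq = perm-injective π (inj (trans (sym (⊙-lookup a π i)) (trans eq (⊙-lookup a π j))))

⊙-faithful : (a : Perm n) → Inj a → {α β : Permutation′ n} → a ⊙ α ≡ a ⊙ β → α ≈ β
⊙-faithful a inj {α} {β} eq i =
  inj (trans (sym (⊙-lookup a α i)) (trans (cong (λ v → lookup v i) eq) (⊙-lookup a β i)))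

⊙-transitive : (a b : Perm n) (ia : Inj a) (ib : Inj b) → a ⊙ (flip (toPerm a ia) · toPerm b ib) ≡ b
⊙-transitive a b ia ib =
  trans (Vec.tabulate-cong λ i → inv-right a ia (lookup b i)) (Vec.tabulate∘lookup b)

-- Left invariance: a⁻¹(aπ) is `π`. The additive premise keeps truncated subtraction out of later
-- arguments.
dist-⊙ : (a : Perm n) → Inj a → (π : Permutation′ n) {p : ℕ} → cyc π + p ≡ n → dist a (a ⊙ π) ≡ p
dist-⊙ {n} a inj π {p} eq = begin
  n ∸ cyc (flip (toPerm a inj) · toPerm (a ⊙ π) (⊙-Inj a π inj))
    ≡⟨ cong (n ∸_) (cyc-cong {π = flip (toPerm a inj) · toPerm (a ⊙ π) (⊙-Inj a π inj)} {π}
         λ i → trans (cong (inv a) (⊙-lookup a π i)) (inv-left a inj _)) ⟩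
  n ∸ cyc π              ≡⟨ cong (_∸ cyc π) eq ⟨
  (cyc π + p) ∸ cyc π    ≡⟨ m+n∸m≡n (cyc π) p ⟩
  p                      ∎
  where open ≡-Reasoning

dist-refl : (a : Perm n) → Inj a → dist a a ≡ 0
dist-refl {n} a inj = subst (λ b → dist a b ≡ 0) (⊙-id a) (dist-⊙ a inj id (trans (+-identityʳ _) (cyc-id n)))

midpoint : (a : Perm n) → Inj a → (α β : Permutation′ n) (p q : ℕ) →
  cyc α + p ≡ n → cyc β + q ≡ n → cyc (α · β) + (p + q) ≡ n → p ≤ suc q → q ≤ suc p →
  T (isMidpoint a (a ⊙ (α · β)) (a ⊙ α))
midpoint a inj α β p q eα eβ eαβ p≤ q≤
  -- The endpoint is split as `a ⊙ α ⊙ β` to evaluate the second leg, then regrouped to evaluate the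
  -- whole distance.
  rewrite sym (⊙-assoc a α β) | dist-⊙ (a ⊙ α) (⊙-Inj a α inj) β eβ | dist-⊙ a inj α eα
        | ⊙-assoc a α β | dist-⊙ a inj (α · β) eαβ =
  Equivalence.from T-∧ (≡⇒≡ᵇ (p + q) (p + q) refl ,
    Equivalence.from T-∧ (≤⇒≤ᵇ p≤ , ≤⇒≤ᵇ q≤))

-- Encoding pairs of endpoints by pairs of midpoints

∈-midSet : (A B : Subset n) {a b m : Perm n} → a ∈ elems A → b ∈ elems B → Inj m →
  T (isMidpoint a b m) → m ∈ midSet A B
∈-midSet A B a∈ b∈ im t =
  ∈-filterB⁺ _ (∈-Sym im) (Any.any⁺ _ (lose a∈ (Any.any⁺ _ (lose b∈ t))))

-- With τ = half true c and κ = half false c, the midpoint pair (m , mκτ⁻¹) encodes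
-- (mτ⁻¹ , mκ) and (mκ , mκτ⁻¹κ⁻¹). Since mκ is the second entry of the former and the first
-- entry of the latter, they cannot both lie in A × B for disjoint A and B.
Encodes : Bool × (Perm n × Perm n) → Perm n × Perm n → Set
Encodes (true , a , b) (m , m′) = ∃ λ c →
  m′ ≡ m ⊙ ratio true c × a ≡ m ⊙ flip (half true c) × b ≡ m ⊙ half false c
Encodes (false , a , b) (m , m′) = ∃ λ c →
  m′ ≡ m ⊙ ratio true c × a ≡ m ⊙ half false c × b ≡ m′ ⊙ flip (half false c)

module _ (A B : Subset n) where

  encode : (s : Bool) (a b : Perm n) → a ∈ elems A → b ∈ elems B →
    ∃ λ mm → mm ∈ cartesianProduct (midSet A B) (midSet A B) × Inj (proj₁ mm) × Encodes (s , a , b) mm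
  encode true a b a∈ b∈ with halves-surjective true (flip (toPerm a (elems-Inj A a∈)) · toPerm b (elems-Inj B b∈))
  ... | c , eq = (a ⊙ τ , a ⊙ (τ · κ · flip τ)) ,
    ∈-cartesianProduct⁺
      (∈-midSet A B a∈ b∈ im (subst (λ z → T (isMidpoint a z (a ⊙ τ))) b≡
        (midpoint a ia τ κ p q (cyc-half true c) (cyc-half false c) (cyc-halves true c) t≤ f≤)))
      -- The second midpoint comes from τκ = (τκτ⁻¹)τ, with legs of lengths `q` and `p`.
      (∈-midSet A B a∈ b∈ (⊙-Inj a (τ · κ · flip τ) ia) (subst (λ z → T (isMidpoint a z (a ⊙ (τ · κ · flip τ)))) b≡′
        (midpoint a ia (τ · κ · flip τ) τ q p
          (trans (cong (_+ q) (cyc-conj τ κ)) (cyc-half false c)) (cyc-half true c)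
          (trans (cong₂ _+_ (cyc-cong {π = τ · κ · flip τ · τ} {τ · κ} cancel) (+-comm q p))
            (cyc-halves true c))
          f≤ t≤))) ,
    im , c ,
    sym (⊙-assoc a τ (ratio true c)) ,
    sym (trans (⊙-assoc a τ (flip τ)) (trans (⊙-cong a {τ · flip τ} {id} λ i → inverseʳ τ) (⊙-id a))) ,
    sym (trans (⊙-assoc a τ κ) b≡)
    where
    τ = half true c
    κ = half false c
    p = size true c
    q = size false c
    ia = elems-Inj A a∈
    ib = elems-Inj B b∈
    im = ⊙-Inj a τ ia
    t≤ = proj₂ (size-balanced c)
    f≤ = m≤n⇒m≤1+n (proj₁ (size-balanced c))
    cancel : τ · κ · flip τ · τ ≈ τ · κ
    cancel i = cong ((τ · κ) ⟨$⟩ʳ_) (inverseˡ τ)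
    b≡ : a ⊙ (τ · κ) ≡ b
    b≡ = trans (⊙-cong a {τ · κ} {flip (toPerm a ia) · toPerm b ib} eq) (⊙-transitive a b ia ib)
    b≡′ : a ⊙ (τ · κ · flip τ · τ) ≡ b
    b≡′ = trans (⊙-cong a {τ · κ · flip τ · τ} {τ · κ} cancel) b≡
  -- The code is taken for the inverse of a⁻¹b, so a⁻¹b = τ⁻¹κ⁻¹ = κ⁻¹(κτ⁻¹κ⁻¹). The second
  -- factorisation gives the first midpoint.
  encode false a b a∈ b∈ with halves-surjective false (flip (flip (toPerm a (elems-Inj A a∈)) · toPerm b (elems-Inj B b∈)))
  ... | c , eq = (a ⊙ flip κ , a ⊙ flip τ) ,
    ∈-cartesianProduct⁺
      (∈-midSet A B a∈ b∈ im (subst (λ z → T (isMidpoint a z (a ⊙ flip κ))) b≡′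
        (midpoint a ia (flip κ) (κ · flip τ · flip κ) q p
          (trans (cong (_+ q) (cyc-flip κ)) (cyc-half false c))
          (trans (cong (_+ p) (trans (cyc-conj κ (flip τ)) (cyc-flip τ))) (cyc-half true c))
          (trans (cong (_+ (q + p)) (trans (cyc-cong {π = flip κ · (κ · flip τ · flip κ)} {flip (κ · τ)} cancel) (cyc-flip (κ · τ))))
            (cyc-halves false c))
          f≤ t≤)))
      (∈-midSet A B a∈ b∈ (⊙-Inj a (flip τ) ia) (subst (λ z → T (isMidpoint a z (a ⊙ flip τ))) b≡
        (midpoint a ia (flip τ) (flip κ) p q
          (trans (cong (_+ p) (cyc-flip τ)) (cyc-half true c))
          (trans (cong (_+ q) (cyc-flip κ)) (cyc-half false c))
          (trans (cong₂ _+_ (cyc-flip (κ · τ)) (+-comm p q)) (cyc-halves false c))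
          t≤ f≤))) ,
    im , c ,
    sym (trans (⊙-assoc a (flip κ) (ratio true c)) (⊙-cong a {flip κ · ratio true c} {flip τ} λ i → inverseˡ κ)) ,
    sym (trans (⊙-assoc a (flip κ) κ) (trans (⊙-cong a {flip κ · κ} {id} λ i → inverseˡ κ) (⊙-id a))) ,
    sym (trans (⊙-assoc a (flip τ) (flip κ)) b≡)
    where
    τ = half true c
    κ = half false c
    p = size true c
    q = size false c
    ia = elems-Inj A a∈
    ib = elems-Inj B b∈
    im = ⊙-Inj a (flip κ) ia
    t≤ = proj₂ (size-balanced c)
    f≤ = m≤n⇒m≤1+n (proj₁ (size-balanced c))
    cancel : flip κ · (κ · flip τ · flip κ) ≈ flip (κ · τ)
    cancel i = inverseˡ κ
    σ = flip (toPerm a ia) · toPerm b ib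
    b≡ : a ⊙ (flip τ · flip κ) ≡ b
    b≡ = trans (⊙-cong a {flip τ · flip κ} {σ} (flip-≈ (κ · τ) σ eq)) (⊙-transitive a b ia ib)
    b≡′ : a ⊙ (flip κ · (κ · flip τ · flip κ)) ≡ b
    b≡′ = trans (⊙-cong a {flip κ · (κ · flip τ · flip κ)} {flip τ · flip κ} cancel) b≡

  -- The tags list the encodings in use. Disjointness is asked only for two distinct tags: one tag
  -- serves every `A` and `B`, and two tags double the bound for disjoint sets.
  copies-bound : (copies : List Bool) → Unique copies →
    (∀ {s t} → s ∈ copies → t ∈ copies → s ≢ t → ∀ {a} → a ∈ elems A → a ∈ elems B → ⊥) →
    length copies * (card A * card B) ≤ length (midSet A B) * length (midSet A B)
  copies-bound copies u disjoint = subst₂ _≤_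
    (trans (length-cartesianProduct copies pairs) (cong (length copies *_) (length-cartesianProduct (elems A) (elems B))))
    (length-cartesianProduct (midSet A B) (midSet A B))
    (count-by-relation (λ x mm → Inj (proj₁ mm) × Encodes x mm) _ _
      (Unique.cartesianProduct⁺ u (Unique.cartesianProduct⁺ (elems-unique A) (elems-unique B)))
      (λ { (s , a , b) x∈ → let _ , ab∈ = ∈-cartesianProduct⁻ copies pairs x∈
                                a∈ , b∈ = ∈-cartesianProduct⁻ (elems A) (elems B) ab∈
                            in encode s a b a∈ b∈ })
      injective)
    where
    pairs = cartesianProduct (elems A) (elems B)
    all-pairs = cartesianProduct copies pairs
    -- Cancelling the injective table `m` leaves equal ratios, hence equal codes.
    same : ∀ (m : Perm n) {m′} c d → Inj m → m′ ≡ m ⊙ ratio true c → m′ ≡ m ⊙ ratio true d → c ≡ d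
    same m c d im e e′ =
      ratio-injective true c d (⊙-faithful m im {ratio true c} {ratio true d} (trans (sym e) e′))
    clash : ∀ {a b b′} → (true , a , b) ∈ all-pairs → (false , b , b′) ∈ all-pairs → ⊥
    clash x∈ y∈ =
      let s∈ , ab∈ = ∈-cartesianProduct⁻ copies pairs x∈
          t∈ , bb′∈ = ∈-cartesianProduct⁻ copies pairs y∈
      in disjoint s∈ t∈ (λ ()) (proj₁ (∈-cartesianProduct⁻ (elems A) (elems B) bb′∈))
           (proj₂ (∈-cartesianProduct⁻ (elems A) (elems B) ab∈))
    injective : ∀ {x y mm} → x ∈ all-pairs → y ∈ all-pairs →
      Inj (proj₁ mm) × Encodes x mm → Inj (proj₁ mm) × Encodes y mm → x ≡ y
    injective {true , _} {true , _} {m , _} _ _ (im , c , e , refl , refl) (_ , d , e′ , refl , refl)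
      with refl ← same m c d im e e′ = refl
    injective {false , _} {false , _} {m , _} _ _ (im , c , e , refl , refl) (_ , d , e′ , refl , refl)
      with refl ← same m c d im e e′ = refl
    injective {true , _} {false , _} {m , _} x∈ y∈ (im , c , e , refl , refl) (_ , d , e′ , refl , refl)
      with refl ← same m c d im e e′ = ⊥-elim (clash x∈ y∈)
    injective {false , _} {true , _} {m , _} x∈ y∈ (im , c , e , refl , refl) (_ , d , e′ , refl , refl)
      with refl ← same m c d im e e′ = ⊥-elim (clash y∈ x∈)

-- Distances between sets

foldr-⊓-≤ : ∀ d {x} {xs : List ℕ} → x ∈ xs → foldr _⊓_ d xs ≤ x
foldr-⊓-≤ d (here refl) = m⊓n≤m _ _
foldr-⊓-≤ d {xs = y ∷ _} (there x∈) = ≤-trans (m⊓n≤n y _) (foldr-⊓-≤ d x∈)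

setDist-≤ : (A B : Subset n) {a b : Perm n} → a ∈ elems A → b ∈ elems B → setDist A B ≤ dist a b
setDist-≤ {n} A B a∈ b∈ = foldr-⊓-≤ n
  (subst (_ ∈_) (sym (concatMap-cartesianProductWith dist (elems A) (elems B)))
    (∈-cartesianProductWith⁺ dist a∈ b∈))

-- There is at least one cycle, as `zero` is always a leader.
dist-≤ : 2 ≤ n → (a b : Perm n) → dist a b ≤ n ∸ 1
dist-≤ {suc n} _ a b = ∸-monoʳ-≤ (suc n)
  (≤-trans (s≤s z≤n) (≤-reflexive (sym (cong length
    (filterB-accept (isLeader σ) zero (tabulate suc) (zero-leads σ))))))
  where σ = λ i → inv a (lookup b i)

element : (xs : List X) → 1 ≤ length xs → ∃ λ x → x ∈ xs
element (x ∷ xs) _ = x , here refl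

-- The inequality in exponential form

^-distribʳ-* : ∀ N x y → (x * y) ^ N ≡ x ^ N * y ^ N
^-distribʳ-* zero x y = refl
^-distribʳ-* (suc N) x y =
  trans (cong (x * y *_) (^-distribʳ-* N x y)) ([m*n]*[o*p]≡[m*o]*[n*p] x y (x ^ N) (y ^ N))

-- To be applied with `N` = (n - 1)², `e` = d(A,B)² and `c` the number of encodings.
curvature-bound : (c ab m N e : ℕ) → c * ab ≤ m * m → 2 ^ e ≤ c ^ N → ab ^ N * 2 ^ e ≤ m ^ (2 * N)
curvature-bound c ab m N e bound 2^e≤c^N = begin
  ab ^ N * 2 ^ e    ≤⟨ *-monoʳ-≤ (ab ^ N) 2^e≤c^N ⟩
  ab ^ N * c ^ N    ≡⟨ *-comm (ab ^ N) (c ^ N) ⟩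
  c ^ N * ab ^ N    ≡⟨ ^-distribʳ-* N c ab ⟨
  (c * ab) ^ N      ≤⟨ ^-monoˡ-≤ N bound ⟩
  (m * m) ^ N       ≡⟨ cong (λ z → (m * z) ^ N) (*-identityʳ m) ⟨
  (m ^ 2) ^ N       ≡⟨ ^-*-assoc m 2 N ⟩
  m ^ (2 * N)       ∎
  where open ≤-Reasoning

-- Multiplying the logarithmic inequality by 2(n - 1)² turns the coefficient K/8 into log 2;
-- exponentiating gives this form.
theorem4p2 : (n : ℕ) → 2 ≤ n → (A B : Subset n) → 1 ≤ card A → 1 ≤ card B →
    (card A * card B) ^ ((n ∸ 1) ^ 2) * 2 ^ (setDist A B ^ 2)
    ≤ length (midSet A B) ^ (2 * (n ∸ 1) ^ 2)
theorem4p2 n 2≤n A B 1≤A 1≤B with setDist A B ≟ 0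
-- At distance zero the curvature factor is 1, so one encoding suffices.
... | yes d≡0 = curvature-bound 1 (card A * card B) (length (midSet A B)) ((n ∸ 1) ^ 2) (setDist A B ^ 2)
  (copies-bound A B (true ∷ []) ([] ∷ [])
    λ { (here refl) (here refl) s≢s → contradiction refl s≢s })
  (≤-reflexive (trans (cong (λ d → 2 ^ (d ^ 2)) d≡0) (sym (^-zeroˡ ((n ∸ 1) ^ 2)))))
-- A common element of `A` and `B` would force distance zero, so both encodings count, and d ≤ n - 1
-- compares the powers of 2.
... | no d≢0 = curvature-bound 2 (card A * card B) (length (midSet A B)) ((n ∸ 1) ^ 2) (setDist A B ^ 2)
  (copies-bound A B (true ∷ false ∷ []) (((λ ()) ∷ []) ∷ [] ∷ [])
    λ _ _ _ {a} a∈A a∈B → d≢0 (n≤0⇒n≡0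
      (≤-trans (setDist-≤ A B a∈A a∈B) (≤-reflexive (dist-refl a (elems-Inj A a∈A))))))
  (^-monoʳ-≤ 2 (^-monoˡ-≤ 2 d≤n-1))
  where
  d≤n-1 : setDist A B ≤ n ∸ 1
  d≤n-1 with a , a∈ ← element (elems A) 1≤A | b , b∈ ← element (elems B) 1≤B =
    ≤-trans (setDist-≤ A B a∈ b∈) (dist-≤ 2≤n a b)
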